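{- There exists a $3$-partite $3$-uniform hypergraph $\mathcal{H}$ such that for every pair of vertices $p,q$ of $\mathcal{H}$, deleting $p$ and $q$ does not reduce the matching number, i.e. $\nu(\mathcal{H}-\{p,q\})=\nu(\mathcal{H})$.
   Context: An $r$-partite $r$-uniform hypergraph has a vertex set partitioned into $r$ parts $V_1,\dots,V_r$ and a set of edges, each edge containing exactly one vertex from each part. A matching is a set of pairwise disjoint edges; $\nu(\mathcal{H})$ is the maximum size of a matching. Deleting a set $S$ of vertices from $\mathcal{H}$ means removing the vertices of $S$ together with all edges containing a vertex of $S$; the result is denoted $\mathcal{H}-S$. -}

module Defs where

import Data.Bool.Properties as Bool
open import Data.Empty using (⊥-elim)
open import Data.Fin.Base using (Fin)
open import Data.Fin.Subset using (Subset; Empty; _⊆_; _∩_; _─_) renaming (_∈_ to _∈ˢ_)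
open import Data.Fin.Subset.Properties using (nonempty?; ∩-comm; x∈p∧x∉q⇒x∈p─q; x∈p∩q⁺)
open import Data.List.Base using (List; []; _∷_; _++_; map; filter; length)
open import Data.List.Extrema.Nat using (argmax; argmax-sel; f[xs]≤f[argmax])
open import Data.List.Membership.Propositional using (_∈_)
open import Data.List.Membership.Propositional.Properties using (∈-filter⁺; ∈-filter⁻; ∈-map⁺; ∈-++⁺ˡ; ∈-++⁺ʳ; ∈-++⁻; ∈-∃++)
open import Data.List.Properties using (length-++)
open import Data.List.Relation.Unary.All as All using (All; []; _∷_)
open import Data.List.Relation.Unary.AllPairs as AllPairs using (AllPairs; []; _∷_)
open import Data.List.Relation.Unary.Any using (here; there)
open import Data.List.Relation.Unary.Unique.Propositional using (Unique)
import Data.List.Relation.Unary.Unique.Propositional.Properties as Unique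
open import Data.Nat.Base using (ℕ; suc; _≤_; z≤n; s≤s)
open import Data.Nat.Properties using (≤-trans; ≤-reflexive; +-suc)
open import Data.Product.Base using (_×_; _,_; proj₁; proj₂; ∃-syntax)
open import Data.Product using (∃!)
open import Data.Sum.Base using (inj₁; inj₂)
open import Data.Vec.Properties using (≡-dec)
open import Level using (Level)
open import Relation.Binary.Definitions using (DecidableEquality)
open import Relation.Binary.PropositionalEquality using (_≡_; refl; sym; trans; cong; subst)
open import Relation.Nullary using (Dec; yes; no; ¬_; ¬?)
open import Relation.Nullary.Decidable using (_×-dec_; map′)

private
  variable
    a : Level
    A : Set a
    r n : ℕ

-- The vertex set is a subset of the ambient set Fin n, so that deleting
-- vertices does not require renaming the remaining ones.  The edge set is a
-- duplicate-free list.
record PartiteHypergraph (r n : ℕ) : Set where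
  field
    vertices   : Subset n
    part       : Fin n → Fin r
    edges      : List (Subset n)
    distinct   : Unique edges
    edge⊆      : ∀ {e} → e ∈ edges → e ⊆ vertices
    transverse : ∀ {e} → e ∈ edges → ∀ i → ∃! _≡_ (λ v → v ∈ˢ e × part v ≡ i)

open PartiteHypergraph public

Disjoint : Subset n → Subset n → Set
Disjoint e f = Empty (e ∩ f)

disjoint? : (e f : Subset n) → Dec (Disjoint e f)
disjoint? e f = ¬? (nonempty? (e ∩ f))

deleteVertices : PartiteHypergraph r n → Subset n → PartiteHypergraph r n
deleteVertices H S = record
  { vertices   = vertices H ─ S
  ; part       = part H
  ; edges      = filter (λ e → disjoint? e S) (edges H)
  ; distinct   = Unique.filter⁺ (λ e → disjoint? e S) (distinct H)
  ; edge⊆      = λ e∈ {v} v∈e → let (e∈H , e∩S≡∅) = ∈-filter⁻ (λ e → disjoint? e S) e∈ in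
                   x∈p∧x∉q⇒x∈p─q (edge⊆ H e∈H v∈e) (λ v∈S → e∩S≡∅ (v , x∈p∩q⁺ (v∈e , v∈S)))
  ; transverse = λ e∈ → transverse H (proj₁ (∈-filter⁻ (λ e → disjoint? e S) e∈))
  }

record IsMatching (H : PartiteHypergraph r n) (M : List (Subset n)) : Set where
  constructor mkMatching
  field
    ⊆edges           : All (_∈ edges H) M
    unique           : Unique M
    pairwiseDisjoint : AllPairs Disjoint M

open IsMatching public

_≟ˢ_ : DecidableEquality (Subset n)
_≟ˢ_ = ≡-dec Bool._≟_

module _ {n : ℕ} where
  open import Data.List.Membership.DecPropositional (_≟ˢ_ {n}) public using (_∈?_)
  open import Data.List.Relation.Unary.Unique.DecPropositional (_≟ˢ_ {n}) public using (unique?)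

isMatching? : (H : PartiteHypergraph r n) (M : List (Subset n)) → Dec (IsMatching H M)
isMatching? H M = map′ (λ (s , u , d) → mkMatching s u d) (λ m → ⊆edges m , unique m , pairwiseDisjoint m)
  (All.all? (_∈? edges H) M ×-dec unique? M ×-dec AllPairs.allPairs? disjoint? M)

sublists : List A → List (List A)
sublists []       = [] ∷ []
sublists (x ∷ xs) = sublists xs ++ map (x ∷_) (sublists xs)

maximumMatching : PartiteHypergraph r n → List (Subset n)
maximumMatching H = argmax length [] (filter (isMatching? H) (sublists (edges H)))

-- Every matching is, up to reordering, a sublist of the edge list, so ν is the
-- maximum over all matchings; see ν-attained and ν-maximal.
ν : PartiteHypergraph r n → ℕ
ν H = length (maximumMatching H)

ν-attained : (H : PartiteHypergraph r n) → ∃[ M ] (IsMatching H M × length M ≡ ν H)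
ν-attained H = maximumMatching H , isMatching , refl
  where
  isMatching : IsMatching H (maximumMatching H)
  isMatching with argmax-sel length [] (filter (isMatching? H) (sublists (edges H)))
  ... | inj₁ eq = subst (IsMatching H) (sym eq) (mkMatching [] [] [])
  ... | inj₂ M∈ = proj₂ (∈-filter⁻ (isMatching? H) {xs = sublists (edges H)} M∈)

private
  filter∈sublists : (M xs : List (Subset n)) → filter (_∈? M) xs ∈ sublists xs
  filter∈sublists M []       = here refl
  filter∈sublists M (x ∷ xs) with x ∈? M
  ... | yes _ = ∈-++⁺ʳ (sublists xs) (∈-map⁺ (x ∷_) (filter∈sublists M xs))
  ... | no  _ = ∈-++⁺ˡ (filter∈sublists M xs)

  unique-length-≤ : {xs ys : List A} → Unique xs → (∀ {x} → x ∈ xs → x ∈ ys) → length xs ≤ length ys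
  unique-length-≤ [] _ = z≤n
  unique-length-≤ {xs = x ∷ xs} (x∉xs ∷ u) xs⊆ys with ∈-∃++ (xs⊆ys (here refl))
  ... | as , bs , refl = ≤-trans (s≤s (unique-length-≤ u xs⊆as++bs)) (≤-reflexive length-eq)
    where
    xs⊆as++bs : ∀ {y} → y ∈ xs → y ∈ as ++ bs
    xs⊆as++bs y∈xs with ∈-++⁻ as (xs⊆ys (there y∈xs))
    ... | inj₁ y∈as         = ∈-++⁺ˡ y∈as
    ... | inj₂ (here y≡x)   = ⊥-elim (All.lookup x∉xs y∈xs (sym y≡x))
    ... | inj₂ (there y∈bs) = ∈-++⁺ʳ as y∈bs

    length-eq : suc (length (as ++ bs)) ≡ length (as ++ x ∷ bs)
    length-eq = trans (cong suc (length-++ as))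
      (trans (sym (+-suc (length as) (length bs))) (sym (length-++ as)))

  allPairs-lookup : {R : A → A → Set} → (∀ {x y} → R x y → R y x) → ∀ {xs x y} →
                    AllPairs R xs → x ∈ xs → y ∈ xs → ¬ x ≡ y → R x y
  allPairs-lookup s (px ∷ _) (here refl) (here refl) x≢y = ⊥-elim (x≢y refl)
  allPairs-lookup s (px ∷ _) (here refl) (there y∈)  x≢y = All.lookup px y∈
  allPairs-lookup s (px ∷ _) (there x∈)  (here refl) x≢y = s (All.lookup px x∈)
  allPairs-lookup s (_ ∷ ps) (there x∈)  (there y∈)  x≢y = allPairs-lookup s ps x∈ y∈ x≢y

  allPairs-tabulate : {R : A → A → Set} {xs : List A} → Unique xs →
                      (∀ {x y} → x ∈ xs → y ∈ xs → ¬ x ≡ y → R x y) → AllPairs R xs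
  allPairs-tabulate []       _ = []
  allPairs-tabulate (x∉ ∷ u) h =
    All.tabulate (λ y∈ → h (here refl) (there y∈) (All.lookup x∉ y∈)) ∷
    allPairs-tabulate u (λ x∈ y∈ → h (there x∈) (there y∈))

  disjoint-sym : {e f : Subset n} → Disjoint e f → Disjoint f e
  disjoint-sym {e = e} {f} = subst Empty (∩-comm e f)

ν-maximal : (H : PartiteHypergraph r n) {M : List (Subset n)} → IsMatching H M → length M ≤ ν H
ν-maximal H {M} m = ≤-trans
  (unique-length-≤ (unique m) (λ x∈M → ∈-filter⁺ (_∈? M) (All.lookup (⊆edges m) x∈M) x∈M))
  (All.lookup (f[xs]≤f[argmax] {f = length} [] (filter (isMatching? H) (sublists (edges H))))
              (∈-filter⁺ (isMatching? H) (filter∈sublists M (edges H)) isMatching))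
  where
  M′ : List (Subset _)
  M′ = filter (_∈? M) (edges H)

  M′⊆M : ∀ {x} → x ∈ M′ → x ∈ M
  M′⊆M x∈ = proj₂ (∈-filter⁻ (_∈? M) {xs = edges H} x∈)

  M′-unique : Unique M′
  M′-unique = Unique.filter⁺ (_∈? M) (distinct H)

  isMatching : IsMatching H M′
  isMatching = mkMatching
    (All.tabulate (λ x∈ → proj₁ (∈-filter⁻ (_∈? M) x∈)))
    M′-unique
    (allPairs-tabulate M′-unique (λ x∈ y∈ →
      allPairs-lookup (λ {e} {f} → disjoint-sym {e = e} {f}) (pairwiseDisjoint m) (M′⊆M x∈) (M′⊆M y∈)))

-- H is dual to the generalized Petersen graph GP(11,2): its hyperedges are the
-- 22 vertices uᵢ, vᵢ of the graph (uᵢ ~ uᵢ₊₁, uᵢ ~ vᵢ, vᵢ ~ vᵢ₊₂, indices mod 11),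
-- its vertices are the 33 edges of the graph, and its parts are the colour
-- classes of a proper 3-edge-colouring.  Matchings of H are independent sets of
-- GP(11,2).  Five consecutive indices carry at most 4 independent vertices, and
-- each vertex lies in 5 of the 11 such windows, so 5 ν(H) ≤ 44 and ν(H) ≤ 8.
-- Conversely, the rotations of six independent sets of size 8 avoid every pair
-- of edges of GP(11,2).
module Submission where

open import Defs
open import Algebra.Properties.CommutativeSemigroup using (x∙yz≈y∙xz)
open import Data.Bool.Base using (true; false)
open import Data.Fin.Base using (Fin; combine; quotient; remainder; remQuot)
open import Data.Fin.Properties using (_≟_; all?; combine-remQuot; remQuot-combine)
open import Data.Fin.Subset using (Subset; _∈_; _∉_; _∪_; ⁅_⁆; ⊤; ⊥; ⋃)
open import Data.Fin.Subset.Properties using (∈⊤; ∉⊥; ∩-comm; x∈p∩q⁺; x∈p∩q⁻; x∈p∪q⁻; p⊆p∪q; q⊆p∪q; x∈⁅y⁆⇒x≡y) renaming (_∈?_ to _∈ˢ?_)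
open import Data.List.Base using (List; []; _∷_; _++_; map; concatMap; filter; length; upTo)
open import Data.List.Membership.Propositional using (find) renaming (_∈_ to _∈ˡ_)
open import Data.List.Membership.Propositional.Properties using (∈-map⁻; ∈-∃++; ∈-filter⁺; ∈-filter⁻)
open import Data.List.Relation.Binary.Permutation.Propositional using (_↭_; ↭⇒↭ₛ)
open import Data.List.Relation.Binary.Permutation.Propositional.Properties using (All-resp-↭; ↭-length; shift)
import Data.List.Relation.Binary.Permutation.Setoid.Properties as ↭ₛ
open import Data.List.Relation.Unary.All as All using (All; []; _∷_)
import Data.List.Relation.Unary.All.Properties as All
open import Data.List.Relation.Unary.AllPairs using (AllPairs; []; _∷_)
import Data.List.Relation.Unary.AllPairs.Properties as AllPairs
open import Data.List.Relation.Unary.Any as Any using (Any; here; there)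
import Data.List.Relation.Unary.Any.Properties as Any
open import Data.List.Relation.Unary.Unique.Propositional using (Unique)
import Data.List.Relation.Unary.Unique.Propositional.Properties as Unique
open import Data.Nat.Base using (ℕ; suc; _+_; _*_; _⊔_; _≤_; z≤n; s≤s; s≤s⁻¹)
open import Data.Nat.DivMod using (_mod_)
open import Data.Nat.ListAction using (sum)
open import Data.Nat.Properties using (_≤?_; ≤-refl; ≤-reflexive; ≤-trans; ≤-antisym; +-commutativeSemigroup; +-mono-≤; *-zeroʳ; *-suc; *-cancelˡ-<; m≤m⊔n; m≤n⊔m; module ≤-Reasoning)
open import Data.Product.Base using (Σ-syntax; _×_; _,_; proj₁; proj₂)
open import Data.Product using (∃!)
open import Data.Sum.Base using (inj₁; inj₂)
open import Data.Vec.Base using (Vec; []; _∷_; lookup; tabulate; toList)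
open import Data.Vec.Properties using (lookup∘tabulate; []=⇒lookup; lookup⇒[]=)
open import Relation.Binary.PropositionalEquality using (_≡_; _≢_; refl; sym; trans; cong; subst; setoid)
open import Relation.Nullary using (Dec; yes; no; does; contradiction; ¬?)
open import Relation.Nullary.Decidable using (toWitness; dec-true; _×-dec_)

private
  variable
    r m n : ℕ
    S : Subset n
    es M : List (Subset n)

disjoint-sym : {e f : Subset n} → Disjoint e f → Disjoint f e
disjoint-sym {e = e} {f} d (v , v∈) = d (v , subst (v ∈_) (∩-comm f e) v∈)

disjoint-∪ : {e f g : Subset n} → Disjoint e f → Disjoint e g → Disjoint e (f ∪ g)
disjoint-∪ {e = e} {f} {g} d d′ (v , v∈) with x∈p∩q⁻ e (f ∪ g) v∈
... | v∈e , v∈f∪g with x∈p∪q⁻ f g v∈f∪g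
... | inj₁ v∈f = d (v , x∈p∩q⁺ (v∈e , v∈f))
... | inj₂ v∈g = d′ (v , x∈p∩q⁺ (v∈e , v∈g))

-- Transversals and the hypergraphs they form

-- `Fin (r * m)` is read as `r` blocks of `m` vertices; the blocks are the parts, and `t` picks one
-- vertex in each.
transversal : Vec (Fin m) r → Subset (r * m)
transversal {m} {r} t = tabulate λ v → does (lookup t (quotient m v) ≟ remainder {r} m v)

∈-transversal⁺ : (t : Vec (Fin m) r) (i : Fin r) → combine i (lookup t i) ∈ transversal t
∈-transversal⁺ {m} {r} t i = lookup⇒[]= v (transversal t)
  (trans (lookup∘tabulate _ v) (dec-true (_ ≟ _) eq))
  where
  v : Fin (r * m)
  v = combine i (lookup t i)
  split : remQuot m v ≡ (i , lookup t i)
  split = remQuot-combine i (lookup t i)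
  eq : lookup t (quotient m v) ≡ remainder {r} m v
  eq = trans (cong (λ qr → lookup t (proj₁ qr)) split) (sym (cong proj₂ split))

∈-transversal⁻ : (t : Vec (Fin m) r) {v : Fin (r * m)} → v ∈ transversal t →
                 combine (quotient {r} m v) (lookup t (quotient m v)) ≡ v
∈-transversal⁻ {m} {r} t {v} v∈
  -- The second scrutinee rules out `no`, where its type becomes `false ≡ true`.
  with lookup t (quotient m v) ≟ remainder {r} m v | trans (sym (lookup∘tabulate _ v)) ([]=⇒lookup v∈)
... | yes eq | _ = trans (cong (combine (quotient {r} m v)) eq) (combine-remQuot {r} m v)

transversal-∃! : (t : Vec (Fin m) r) (i : Fin r) →
                 ∃! _≡_ λ v → v ∈ transversal t × quotient m v ≡ i
transversal-∃! {m} t i =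
  combine i (lookup t i) ,
  (∈-transversal⁺ t i , cong proj₁ (remQuot-combine i (lookup t i))) ,
  λ { (v∈ , refl) → ∈-transversal⁻ t v∈ }

fromTransversals : (ts : List (Vec (Fin m) r)) → Unique (map transversal ts) → PartiteHypergraph r (r * m)
fromTransversals {m} ts distinct = record
  { vertices   = ⊤
  ; part       = quotient m
  ; edges      = map transversal ts
  ; distinct   = distinct
  ; edge⊆      = λ _ _ → ∈⊤
  ; transverse = λ e∈ i → transverse′ (∈-map⁻ transversal e∈) i
  }
  where
  transverse′ : ∀ {e} → Σ[ t ∈ Vec (Fin m) _ ] (t ∈ˡ ts × e ≡ transversal t) →
                ∀ i → ∃! _≡_ λ v → v ∈ e × quotient m v ≡ i
  transverse′ (t , _ , refl) = transversal-∃! t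

-- Upper bounds on matchings

-- Skip-or-take search for a largest pairwise disjoint subfamily of `es` avoiding `S`. The blocked
-- set `S` absorbs each edge taken, so conflicting edges are dropped without branching.
packing : Subset n → List (Subset n) → ℕ
packing S []       = 0
packing S (e ∷ es) with does (disjoint? e S)
... | true  = packing S es ⊔ suc (packing (e ∪ S) es)
... | false = packing S es

∈-∷⁻ : {A : Set} {x y : A} {ys : List A} → x ∈ˡ y ∷ ys → y ≢ x → x ∈ˡ ys
∈-∷⁻ (here refl) y≢x = contradiction refl y≢x
∈-∷⁻ (there x∈)  _   = x∈

packing-skip : (S e : Subset n) (es : List (Subset n)) → packing S es ≤ packing S (e ∷ es)
packing-skip S e es with does (disjoint? e S)
... | true  = m≤m⊔n _ _
... | false = ≤-refl

packing-take : (S e : Subset n) (es : List (Subset n)) → Disjoint e S →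
               suc (packing (e ∪ S) es) ≤ packing S (e ∷ es)
packing-take S e es d rewrite dec-true (disjoint? e S) d = m≤n⊔m _ _

-- `M` follows one branch of the search. If `e` is not in `M`, skip it; otherwise permute `e` to the
-- front of `M`, and the remaining edges avoid both `e` and `S`.
length≤packing : All (_∈ˡ es) M → Unique M → AllPairs Disjoint M →
                 All (λ e → Disjoint e S) M → length M ≤ packing S es
length≤packing {es = []} {M = []} _ _ _ _ = z≤n
length≤packing {es = []} {M = _ ∷ _} (() ∷ _)
length≤packing {es = e ∷ es} {M = M} {S = S} M⊆ u d M∩S≡∅ with e ∈? M
... | no e∉M = ≤-trans
  (length≤packing (All.tabulate λ f∈ → ∈-∷⁻ (All.lookup M⊆ f∈) λ { refl → e∉M f∈ }) u d M∩S≡∅)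
  (packing-skip S e es)
... | yes e∈M with ∈-∃++ e∈M
... | as , bs , refl = begin
  length (as ++ e ∷ bs)        ≡⟨ ↭-length π ⟩
  suc (length (as ++ bs))      ≤⟨ s≤s (rest (All-resp-↭ π M⊆) (↭ₛ.Unique-resp-↭ (setoid _) (↭⇒↭ₛ π) u)
                                          (↭ₛ.AllPairs-resp-↭ (setoid _) (λ {f} {g} → disjoint-sym {e = f} {g})
                                            ((λ { refl x → x }) , (λ { refl x → x })) (↭⇒↭ₛ π) d)
                                          (All-resp-↭ π M∩S≡∅)) ⟩
  suc (packing (e ∪ S) es)     ≤⟨ packing-take S e es (All.lookup M∩S≡∅ e∈M) ⟩
  packing S (e ∷ es)           ∎
  where
  open ≤-Reasoning
  π : as ++ e ∷ bs ↭ e ∷ as ++ bs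
  π = shift e as bs
  rest : ∀ {N} → All (_∈ˡ e ∷ es) (e ∷ N) → Unique (e ∷ N) → AllPairs Disjoint (e ∷ N) →
         All (λ f → Disjoint f S) (e ∷ N) → length N ≤ packing (e ∪ S) es
  rest (_ ∷ N⊆) (e≢ ∷ u) (e# ∷ d) (_ ∷ N∩S≡∅) = length≤packing
    (All.zipWith (λ (f∈ , e≢f) → ∈-∷⁻ f∈ e≢f) (N⊆ , e≢)) u d
    (All.zipWith (λ {f} (e#f , f#S) → disjoint-∪ {e = f} {e} {S} (disjoint-sym {e = e} {f} e#f) f#S) (e# , N∩S≡∅))

incidences : List (Subset n) → List (List (Subset n)) → ℕ
incidences M Ws = sum (map (λ W → length (filter (_∈? W) M)) Ws)

-- Exchange of summation: `incidences` counts pairs window by window, while here they are counted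
-- one edge of `M` at a time.
incidences-∷ : (e : Subset n) (M : List (Subset n)) (Ws : List (List (Subset n))) →
               incidences (e ∷ M) Ws ≡ length (filter (e ∈?_) Ws) + incidences M Ws
incidences-∷ e M []       = refl
incidences-∷ e M (W ∷ Ws) rewrite incidences-∷ e M Ws with does (e ∈? W)
... | true  = cong suc (x∙yz≈y∙xz +-commutativeSemigroup (length (filter (_∈? W) M)) (length (filter (e ∈?_) Ws)) _)
... | false = x∙yz≈y∙xz +-commutativeSemigroup (length (filter (_∈? W) M)) (length (filter (e ∈?_) Ws)) _

≤-incidences : ∀ {k} {M : List (Subset n)} {Ws} → All (λ e → k ≤ length (filter (e ∈?_) Ws)) M →
               k * length M ≤ incidences M Ws
≤-incidences {k = k} {[]} [] = ≤-trans (≤-reflexive (*-zeroʳ k)) z≤n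
≤-incidences {k = k} {e ∷ M} {Ws} (k≤ ∷ ks) = begin
  k * suc (length M)                             ≡⟨ *-suc k (length M) ⟩
  k + k * length M                               ≤⟨ +-mono-≤ k≤ (≤-incidences {Ws = Ws} ks) ⟩
  length (filter (e ∈?_) Ws) + incidences M Ws   ≡⟨ incidences-∷ e M Ws ⟨
  incidences (e ∷ M) Ws                          ∎
  where open ≤-Reasoning

-- The edges of `M` lying in a window form a packing of that window, searched with nothing blocked
-- at the start.
incidences-≤ : ∀ {b} {Ws : List (List (Subset n))} → All (λ W → packing ⊥ W ≤ b) Ws →
               Unique M → AllPairs Disjoint M → incidences M Ws ≤ length Ws * b
incidences-≤ []                     _ _ = z≤n
incidences-≤ {M = M} {Ws = W ∷ _} (W≤b ∷ Ws≤b) u d = +-mono-≤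
  (≤-trans (length≤packing (All.all-filter (_∈? W) M) (Unique.filter⁺ (_∈? W) u)
              (AllPairs.filter⁺ (_∈? W) d) (All.universal disjoint-⊥ _)) W≤b)
  (incidences-≤ Ws≤b u d)
  where
  disjoint-⊥ : ∀ e → Disjoint e ⊥
  disjoint-⊥ e (v , v∈) = ∉⊥ (proj₂ (x∈p∩q⁻ e ⊥ v∈))

-- Double counting of pairs (edge, window) for a maximum matching.
ν-≤-windows : ∀ {k b} (H : PartiteHypergraph r n) (Ws : List (List (Subset n))) →
              All (λ e → k ≤ length (filter (e ∈?_) Ws)) (edges H) → All (λ W → packing ⊥ W ≤ b) Ws →
              k * ν H ≤ length Ws * b
ν-≤-windows {k = k} {b} H Ws cover bounded with ν-attained H
... | M , mkMatching M⊆ u d , eq = subst (λ l → k * l ≤ length Ws * b) eq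
  (≤-trans (≤-incidences {Ws = Ws} (All.map (All.lookup cover) M⊆)) (incidences-≤ bounded u d))

-- Deleting vertices

ν-deleteVertices-≤ : (H : PartiteHypergraph r n) (S : Subset n) → ν (deleteVertices H S) ≤ ν H
ν-deleteVertices-≤ H S with ν-attained (deleteVertices H S)
... | M , mkMatching M⊆ u d , eq = subst (_≤ ν H) eq
  (ν-maximal H (mkMatching (All.map (λ e∈ → proj₁ (∈-filter⁻ (λ e → disjoint? e S) e∈)) M⊆) u d))

≤-ν-deleteVertices : (H : PartiteHypergraph r n) (S : Subset n) → IsMatching H M →
                     All (λ e → Disjoint e S) M → length M ≤ ν (deleteVertices H S)
≤-ν-deleteVertices H S (mkMatching M⊆ u d) M∩S≡∅ = ν-maximal (deleteVertices H S)
  (mkMatching (All.zipWith (λ (e∈ , e#S) → ∈-filter⁺ (λ e → disjoint? e S) e∈ e#S) (M⊆ , M∩S≡∅)) u d)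

disjoint-pair : ∀ {p q : Fin n} (M : List (Subset n)) → p ∉ ⋃ M → q ∉ ⋃ M → All (λ e → Disjoint e (⁅ p ⁆ ∪ ⁅ q ⁆)) M
disjoint-pair []      _  _  = []
disjoint-pair {p = p} {q} (e ∷ M) p∉ q∉ =
  disjoint-∪ {e = e} {⁅ p ⁆} {⁅ q ⁆} (avoid p∉) (avoid q∉) ∷
  disjoint-pair M (λ p∈ → p∉ (q⊆p∪q e (⋃ M) p∈)) (λ q∈ → q∉ (q⊆p∪q e (⋃ M) q∈))
  where
  avoid : ∀ {x} → x ∉ e ∪ ⋃ M → Disjoint e ⁅ x ⁆
  avoid {x} x∉ (v , v∈) with x∈p∩q⁻ e ⁅ x ⁆ v∈
  ... | v∈e , v∈x with x∈⁅y⁆⇒x≡y x v∈x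
  ... | refl = x∉ (p⊆p∪q (⋃ M) v∈e)

≤-ν-delete-pair : ∀ {k} (H : PartiteHypergraph r n) (p q : Fin n) (Ms : List (List (Subset n))) →
                  All (λ M → IsMatching H M × k ≤ length M) Ms → Any (λ U → p ∉ U × q ∉ U) (map ⋃ Ms) →
                  k ≤ ν (deleteVertices H (⁅ p ⁆ ∪ ⁅ q ⁆))
≤-ν-delete-pair H p q Ms valid avoid with find (Any.map⁻ avoid)
... | M , M∈ , p∉ , q∉ with All.lookup valid M∈
... | isM , k≤ = ≤-trans k≤ (≤-ν-deleteVertices H (⁅ p ⁆ ∪ ⁅ q ⁆) isM (disjoint-pair M p∉ q∉))

-- The hypergraph dual to GP(11,2)

-- Entries 2i and 2i+1 stand for uᵢ and vᵢ.  The j-th component numbers the edge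
-- of colour j at that vertex among the 11 edges of this colour.
rows : Vec (Vec (Fin 11) 3) 22
rows = row 0 0 0 ∷ row 0 1 1 ∷ row 1 0 2 ∷ row 1 2 3 ∷ row 2 3 2 ∷ row 2 4 1 ∷
       row 3 3 4 ∷ row 3 5 3 ∷ row 4 6 4 ∷ row 4 4 5 ∷ row 5 6 6 ∷ row 5 5 7 ∷
       row 6 7 6 ∷ row 7 7 5 ∷ row 6 8 8 ∷ row 8 8 7 ∷ row 9 9 8 ∷ row 7 9 9 ∷
       row 9 10 10 ∷ row 8 1 10 ∷ row 10 10 0 ∷ row 10 2 9 ∷ []
  where
  row : ℕ → ℕ → ℕ → Vec (Fin 11) 3
  row a b c = a mod 11 ∷ b mod 11 ∷ c mod 11 ∷ []

distinct-rows : Unique (map transversal (toList rows))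
distinct-rows = toWitness {a? = unique? (map transversal (toList rows))} _

H : PartiteHypergraph 3 33
H = fromTransversals (toList rows) distinct-rows

-- Adding 2 to an index rotates GP(11,2) by one step.
rotations : List ℕ → List (List (Subset 33))
rotations js = map (λ k → map (λ j → transversal (lookup rows ((2 * k + j) mod 22))) js) (upTo 11)

-- Entries 0 to 9 are uᵢ and vᵢ for i = 0, ..., 4.
windows : List (List (Subset 33))
windows = rotations (upTo 10)

windows-cover : All (λ e → 5 ≤ length (filter (e ∈?_) windows)) (edges H)
windows-cover = toWitness {a? = All.all? (λ e → 5 ≤? length (filter (e ∈?_) windows)) (edges H)} _

packing-window : All (λ W → packing ⊥ W ≤ 4) windows
packing-window = toWitness {a? = All.all? (λ W → packing ⊥ W ≤? 4) windows} _

5*ν≤44 : 5 * ν H ≤ 44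
5*ν≤44 = ν-≤-windows {k = 5} {b = 4} H windows windows-cover packing-window

-- Integrality: 44 is one less than `5 * 9`.
ν≤8 : ν H ≤ 8
ν≤8 = bound (ν H) 5*ν≤44
  where
  -- For a variable k, since conversion checking would otherwise evaluate ν H.
  bound : ∀ k → 5 * k ≤ 44 → k ≤ 8
  bound k 5k≤44 = s≤s⁻¹ (*-cancelˡ-< 5 k 9 (s≤s 5k≤44))

-- Base sets use the numbering of `rows`. Eight independent vertices of a cubic graph meet 24 of the
-- 33 edges, so each matching leaves 9 vertices of `H` free.
matchings : List (List (Subset 33))
matchings = concatMap rotations
  ( (3 ∷ 6 ∷ 9 ∷ 10 ∷ 14 ∷ 17 ∷ 19 ∷ 20 ∷ [])
  ∷ (2 ∷ 6 ∷ 9 ∷ 11 ∷ 12 ∷ 16 ∷ 19 ∷ 21 ∷ [])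
  ∷ (3 ∷ 4 ∷ 8 ∷ 11 ∷ 14 ∷ 17 ∷ 19 ∷ 20 ∷ [])
  ∷ (4 ∷ 7 ∷ 9 ∷ 10 ∷ 14 ∷ 17 ∷ 19 ∷ 20 ∷ [])
  ∷ (3 ∷ 5 ∷ 8 ∷ 11 ∷ 13 ∷ 16 ∷ 19 ∷ 20 ∷ [])
  ∷ (3 ∷ 5 ∷ 6 ∷ 10 ∷ 13 ∷ 15 ∷ 16 ∷ 20 ∷ [])
  ∷ [])

matchings-valid : All (λ M → IsMatching H M × 8 ≤ length M) matchings
matchings-valid = toWitness {a? = All.all? (λ M → isMatching? H M ×-dec 8 ≤? length M) matchings} _

-- Us must stay a parameter: the evaluator then shares the 66 unions between all
-- pairs p, q, while inlined at map ⋃ matchings the check is infeasible.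
avoiding? : (Us : List (Subset n)) → Dec (∀ p q → Any (λ U → p ∉ U × q ∉ U) Us)
avoiding? Us = all? λ p → all? λ q → Any.any? (λ U → ¬? (p ∈ˢ? U) ×-dec ¬? (q ∈ˢ? U)) Us

matchings-avoid : ∀ p q → Any (λ U → p ∉ U × q ∉ U) (map ⋃ matchings)
matchings-avoid = toWitness {a? = avoiding? (map ⋃ matchings)} _

theorem1p3 : Σ[ n ∈ ℕ ] Σ[ H ∈ PartiteHypergraph 3 n ]
    (edges H ≢ [] ×
    (∀ p q → p ∈ vertices H → q ∈ vertices H →
    ν (deleteVertices H (⁅ p ⁆ ∪ ⁅ q ⁆)) ≡ ν H))
theorem1p3 = 33 , H , (λ ()) , λ p q _ _ →
  -- For the lower bound, `ν H` is at most 8, and a stored matching of size 8 avoids `p` and `q`.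
  ≤-antisym (ν-deleteVertices-≤ H (⁅ p ⁆ ∪ ⁅ q ⁆)) (≤-trans ν≤8
    (≤-ν-delete-pair H p q matchings matchings-valid (matchings-avoid p q)))
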